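{- Let $J_3$ be the Flower snark on the $12$ vertices $x_0,x_1,x_{ -1},y_0,y_1,y_{ -1},z_0,z_1,z_{ -1},v_0,v_1,v_{ -1}$ whose $18$ edges are: $z_0v_0$, $z_0x_0$, $z_0y_0$, $v_0v_1$, $v_0v_{ -1}$, $v_1v_{ -1}$, $x_0x_1$, $x_0x_{ -1}$, $y_0y_1$, $y_0y_{ -1}$, $v_1z_1$, $v_{ -1}z_{ -1}$, $x_1z_1$, $y_1z_1$, $x_{ -1}z_{ -1}$, $y_{ -1}z_{ -1}$, $x_{ -1}y_1$, $x_1y_{ -1}$. Then $J_3$ is Class~$0$, i.e., its pebbling number is $\pi(J_3)=n(J_3)=12$.
   Context: A configuration $C$ on a graph $G$ assigns to each vertex $v$ a nonnegative integer $C(v)$ (number of pebbles). A pebbling move removes two pebbles from a vertex $v$ and places one pebble on a vertex adjacent to $v$. A configuration is $r$-solvable if some sequence of pebbling moves results in at least one pebble on the target vertex $r$. The pebbling number $\pi(G)$ is the minimum integer $t$ such that for every vertex $r$ of $G$, every configuration with $t$ pebbles in total is $r$-solvable. One always has $\pi(G)\ge n(G)$, the number of vertices, and $G$ is called Class~$0$ if $\pi(G)=n(G)$. The graph $J_3$ (also called Tietze's graph) is the Petersen graph with one vertex replaced by a triangle. -}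

module Defs where

open import Data.Fin using (Fin; #_)
open import Data.Fin.Properties using (_≟_)
open import Data.List.Base using (List; []; _∷_)
open import Data.List.Membership.Propositional using (_∈_)
open import Data.List.Relation.Unary.All as All using (All; all?)
open import Data.Nat.Base using (ℕ; suc; _∸_; _≤_)
open import Data.Product.Base using (_×_; _,_; proj₁; proj₂; ∃-syntax)
open import Data.Sum.Base using (_⊎_; inj₁; inj₂; swap)
open import Data.Vec.Base using (Vec; lookup; sum; updateAt)
open import Level using (0ℓ)
open import Relation.Binary.Core using (Rel)
open import Relation.Binary.Construct.Closure.ReflexiveTransitive using (Star)
open import Relation.Binary.Definitions using (Symmetric)
open import Relation.Binary.PropositionalEquality.Core using (_≡_; _≢_; refl)
open import Relation.Nullary using (¬_)
open import Relation.Nullary.Decidable using (toWitness; ¬?)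

record SimpleGraph (n : ℕ) : Set₁ where
  field
    Adj       : Rel (Fin n) 0ℓ
    symmetric : Symmetric Adj
    loopless  : ∀ v → ¬ Adj v v

open SimpleGraph public

fromEdges : ∀ {n} (es : List (Fin n × Fin n)) →
            All (λ e → proj₁ e ≢ proj₂ e) es → SimpleGraph n
fromEdges es distinct = record
  { Adj       = λ u v → (u , v) ∈ es ⊎ (v , u) ∈ es
  ; symmetric = swap
  ; loopless  = λ where
      _ (inj₁ e) → All.lookup distinct e refl
      _ (inj₂ e) → All.lookup distinct e refl
  }

Configuration : ℕ → Set
Configuration n = Vec ℕ n

-- The truncated subtraction is exact because of the premise 2 ≤ C(u), and the
-- two updates do not interfere because adjacent vertices are distinct.
data Move {n} (G : SimpleGraph n) : Rel (Configuration n) 0ℓ where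
  move : ∀ {C u v} → Adj G u v → 2 ≤ lookup C u →
         Move G C (updateAt (updateAt C u (_∸ 2)) v suc)

Solvable : ∀ {n} → SimpleGraph n → Fin n → Configuration n → Set
Solvable G r C = ∃[ C′ ] (Star (Move G) C C′ × 1 ≤ lookup C′ r)

AlwaysSolvable : ∀ {n} → SimpleGraph n → ℕ → Set
AlwaysSolvable {n} G t =
  ∀ (r : Fin n) (C : Configuration n) → sum C ≡ t → Solvable G r C

-- A relation rather than a function, since π(G) exists only for connected G.
IsPebblingNumber : ∀ {n} → SimpleGraph n → ℕ → Set
IsPebblingNumber G t = AlwaysSolvable G t × (∀ s → AlwaysSolvable G s → t ≤ s)

Class0 : ∀ {n} → SimpleGraph n → Set
Class0 {n} G = IsPebblingNumber G n

x₀ x₁ x₋₁ y₀ y₁ y₋₁ z₀ z₁ z₋₁ v₀ v₁ v₋₁ : Fin 12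
x₀  = # 0
x₁  = # 1
x₋₁ = # 2
y₀  = # 3
y₁  = # 4
y₋₁ = # 5
z₀  = # 6
z₁  = # 7
z₋₁ = # 8
v₀  = # 9
v₁  = # 10
v₋₁ = # 11

J₃-edges : List (Fin 12 × Fin 12)
J₃-edges =
  (z₀ , v₀) ∷ (z₀ , x₀) ∷ (z₀ , y₀) ∷
  (v₀ , v₁) ∷ (v₀ , v₋₁) ∷ (v₁ , v₋₁) ∷
  (x₀ , x₁) ∷ (x₀ , x₋₁) ∷ (y₀ , y₁) ∷ (y₀ , y₋₁) ∷
  (v₁ , z₁) ∷ (v₋₁ , z₋₁) ∷
  (x₁ , z₁) ∷ (y₁ , z₁) ∷ (x₋₁ , z₋₁) ∷ (y₋₁ , z₋₁) ∷
  (x₋₁ , y₁) ∷ (x₁ , y₋₁) ∷ []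

J₃ : SimpleGraph 12
J₃ = fromEdges J₃-edges
  (toWitness {a? = all? (λ e → ¬? (proj₁ e ≟ proj₂ e)) J₃-edges} _)

{-# OPTIONS --safe #-}

-- Fix a root r.  If a tree in the graph hangs from r and its vertices carry
-- weights w that at least halve at every step away from the neighbours of r,
-- then pushing pebbles towards r shows that every C with w · C > w · 1 is
-- r-solvable (Hurlbert's Weight Function Lemma).  For J₃ these inequalities
-- alone do not exclude an unsolvable C with 12 pebbles, so they are combined
-- with branching: the cases C(v) ≤ k and C(v) > k are distinguished
-- for a few vertices, and the lower bounds obtained permit some moves before a
-- tree inequality is applied.  In each resulting box, a nonnegative combination
-- of inequalities excludes 12 pebbles.  By symmetry three roots suffice.
module Submission where

import Algebra.Properties.CommutativeSemigroup as CommutativeSemigroup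
open import Data.Bool.Base using (if_then_else_)
open import Data.Fin.Base using (Fin; zero; suc)
open import Data.Fin.Properties as Fin using (_≟_)
open import Data.List.Base as List using (List; []; _∷_)
import Data.List.Membership.DecPropositional as DecMembership
open import Data.List.Relation.Unary.All using (All; []; _∷_; all?)
open import Data.Nat.Base
open import Data.Nat.GeneralisedArithmetic using (fold)
open import Data.Nat.Properties hiding (_≟_)
open import Data.Nat.Properties using () renaming (_≟_ to _≟ℕ_)
open import Data.Nat.Tactic.RingSolver using (solve-∀)
open import Data.Product.Base using (_×_; _,_)
import Data.Product.Properties as Product
open import Data.Sum.Base using (_⊎_; inj₁; inj₂)
open import Data.Unit.Base using (⊤; tt)
open import Data.Vec.Base
  using (Vec; []; _∷_; lookup; sum; updateAt; zipWith; replicate; _[_]≔_)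
open import Data.Vec.Properties
  using (lookup∘updateAt; lookup∘updateAt′; lookup∘update; lookup∘update′; lookup-replicate)
open import Function.Base using (_∘_)
open import Relation.Binary.Construct.Closure.ReflexiveTransitive using (Star; ε; _◅_; _◅◅_)
open import Relation.Binary.Definitions using (Decidable)
open import Relation.Binary.PropositionalEquality
  using (_≡_; _≢_; refl; sym; trans; cong; cong₂; subst)
open import Relation.Nullary.Decidable
  using (Dec; yes; no; _×-dec_; _⊎-dec_; toWitness; does)
open import Relation.Nullary.Negation using (contradiction)

open import Defs

open CommutativeSemigroup +-commutativeSemigroup
  using (interchange; x∙yz≈y∙xz; xy∙z≈xz∙y)

private
  variable
    n : ℕ

-- Weighted sums of configurations and how updates change them.

infixl 6 _⊕_ _⊖_
infix  7 _·_

_⊕_ _⊖_ : Vec ℕ n → Vec ℕ n → Vec ℕ n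
_⊕_ = zipWith _+_
_⊖_ = zipWith _∸_

_·_ : Vec ℕ n → Vec ℕ n → ℕ
[]      · []      = 0
(a ∷ w) · (c ∷ C) = a * c + w · C

·-suc : ∀ (w C : Vec ℕ n) v → w · updateAt C v suc ≡ lookup w v + w · C
·-suc (a ∷ w) (c ∷ C) zero    = eq a c (w · C)
  where
  eq : ∀ a c s → a * suc c + s ≡ a + (a * c + s)
  eq = solve-∀
·-suc (a ∷ w) (c ∷ C) (suc v) rewrite ·-suc w C v = x∙yz≈y∙xz (a * c) (lookup w v) (w · C)

-- Written additively, so that the weights themselves are never subtracted.
·-∸2 : ∀ (w C : Vec ℕ n) u → 2 ≤ lookup C u →
       2 * lookup w u + w · updateAt C u (_∸ 2) ≡ w · C
·-∸2 (a ∷ w) (suc (suc c) ∷ C) zero    _  = eq a c (w · C)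
  where
  eq : ∀ a c s → 2 * a + (a * c + s) ≡ a * suc (suc c) + s
  eq = solve-∀
·-∸2 (a ∷ w) (suc zero ∷ C)    zero (s≤s ())
·-∸2 (a ∷ w) (c ∷ C)           (suc u) 2≤ rewrite sym (·-∸2 w C u 2≤) =
  x∙yz≈y∙xz (2 * lookup w u) (a * c) (w · updateAt C u (_∸ 2))

·-[]≔ : ∀ (w C : Vec ℕ n) u k → lookup w u ≡ 0 →
        (w [ u ]≔ k) · C ≡ k * lookup C u + w · C
·-[]≔ (_ ∷ w) (c ∷ C) zero    k refl = refl
·-[]≔ (a ∷ w) (c ∷ C) (suc u) k wu≡0 rewrite ·-[]≔ w C u k wu≡0 =
  x∙yz≈y∙xz (a * c) (k * lookup C u) (w · C)

sum-[]≔ : ∀ (w : Vec ℕ n) u k → lookup w u ≡ 0 → sum (w [ u ]≔ k) ≡ k + sum w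
sum-[]≔ (_ ∷ w) zero    k refl = refl
sum-[]≔ (a ∷ w) (suc u) k wu≡0 rewrite sum-[]≔ w u k wu≡0 = x∙yz≈y∙xz a k (sum w)

·-zeroˡ : ∀ (C : Vec ℕ n) → replicate n 0 · C ≡ 0
·-zeroˡ []      = refl
·-zeroˡ (_ ∷ C) = ·-zeroˡ C

sum-⊕ : ∀ (C D : Vec ℕ n) → sum (C ⊕ D) ≡ sum C + sum D
sum-⊕ []      []      = refl
sum-⊕ (c ∷ C) (d ∷ D) rewrite sum-⊕ C D = interchange c d (sum C) (sum D)

·-⊕ˡ : ∀ (v w C : Vec ℕ n) → (v ⊕ w) · C ≡ v · C + w · C
·-⊕ˡ []      []      []      = refl
·-⊕ˡ (a ∷ v) (b ∷ w) (c ∷ C) rewrite ·-⊕ˡ v w C = eq a b c (v · C) (w · C)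
  where
  eq : ∀ a b c s t → (a + b) * c + (s + t) ≡ a * c + s + (b * c + t)
  eq = solve-∀

·-⊕ʳ : ∀ (w C D : Vec ℕ n) → w · (C ⊕ D) ≡ w · C + w · D
·-⊕ʳ []      []      []      = refl
·-⊕ʳ (a ∷ w) (c ∷ C) (d ∷ D) rewrite ·-⊕ʳ w C D = eq a c d (w · C) (w · D)
  where
  eq : ∀ a c d s t → a * (c + d) + (s + t) ≡ a * c + s + (a * d + t)
  eq = solve-∀

⊕-⊖ : ∀ (L C : Vec ℕ n) → (∀ v → lookup L v ≤ lookup C v) → L ⊕ (C ⊖ L) ≡ C
⊕-⊖ []      []      _   = refl
⊕-⊖ (_ ∷ L) (_ ∷ C) L≤C = cong₂ _∷_ (m+[n∸m]≡n (L≤C zero)) (⊕-⊖ L C (L≤C ∘ suc))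

updateAt-⊕-suc : ∀ (C D : Vec ℕ n) v → updateAt (C ⊕ D) v suc ≡ updateAt C v suc ⊕ D
updateAt-⊕-suc (c ∷ C) (d ∷ D) zero    = refl
updateAt-⊕-suc (c ∷ C) (d ∷ D) (suc v) = cong (_ ∷_) (updateAt-⊕-suc C D v)

updateAt-⊕-∸2 : ∀ (C D : Vec ℕ n) u → 2 ≤ lookup C u →
                updateAt (C ⊕ D) u (_∸ 2) ≡ updateAt C u (_∸ 2) ⊕ D
updateAt-⊕-∸2 (c ∷ C) (d ∷ D) zero    2≤c = cong (_∷ C ⊕ D) (+-∸-comm d 2≤c)
updateAt-⊕-∸2 (c ∷ C) (d ∷ D) (suc u) 2≤c = cong (_ ∷_) (updateAt-⊕-∸2 C D u 2≤c)

lookup-⊕-≤ : ∀ (C D : Vec ℕ n) v → lookup C v ≤ lookup (C ⊕ D) v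
lookup-⊕-≤ (c ∷ C) (d ∷ D) zero    = m≤m+n c d
lookup-⊕-≤ (c ∷ C) (d ∷ D) (suc v) = lookup-⊕-≤ C D v

lookup≤sum : ∀ (C : Vec ℕ n) v → lookup C v ≤ sum C
lookup≤sum (c ∷ C) zero    = m≤m+n c (sum C)
lookup≤sum (c ∷ C) (suc v) = ≤-trans (lookup≤sum C v) (m≤n+m (sum C) c)

-- Since `m ≤ k + (m ∸ k)` even for `k > m`, a coefficient `k` that is too large is simply weakened,
-- while one that is too small is topped up by the bound `o`.
m*n≤k*n+[m∸k]*o : ∀ m k {n o} → n ≤ o → m * n ≤ k * n + (m ∸ k) * o
m*n≤k*n+[m∸k]*o m k {n} {o} n≤o = begin
  m * n                    ≤⟨ *-monoˡ-≤ n (m≤n+m∸n m k) ⟩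
  (k + (m ∸ k)) * n        ≡⟨ *-distribʳ-+ n k (m ∸ k) ⟩
  k * n + (m ∸ k) * n      ≤⟨ +-monoʳ-≤ (k * n) (*-monoʳ-≤ (m ∸ k) n≤o) ⟩
  k * n + (m ∸ k) * o      ∎
  where open ≤-Reasoning

-- The preceding estimate, summed over the vertices. It turns the uneven coefficients `a` of a
-- combination of inequalities into the uniform coefficient `μ`, at a cost that depends only on the
-- box.
scaled-sum-≤ : ∀ μ (a L U C : Vec ℕ n) → (∀ v → lookup C v ≤ lookup U v) →
               μ * sum (C ⊖ L) ≤ a · (C ⊖ L) + (replicate n μ ⊖ a) · (U ⊖ L)
scaled-sum-≤ μ []      []      []      []      _   = ≤-reflexive (*-zeroʳ μ)
scaled-sum-≤ μ (k ∷ a) (l ∷ L) (u ∷ U) (c ∷ C) C≤U = begin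
  μ * (c ∸ l + sum (C ⊖ L))
    ≡⟨ *-distribˡ-+ μ (c ∸ l) _ ⟩
  μ * (c ∸ l) + μ * sum (C ⊖ L)
    ≤⟨ +-mono-≤ (m*n≤k*n+[m∸k]*o μ k (∸-monoˡ-≤ l (C≤U zero)))
                (scaled-sum-≤ μ a L U C (C≤U ∘ suc)) ⟩
  k * (c ∸ l) + (μ ∸ k) * (u ∸ l) + (a · (C ⊖ L) + _)
    ≡⟨ interchange (k * (c ∸ l)) ((μ ∸ k) * (u ∸ l)) (a · (C ⊖ L)) _ ⟩
  k * (c ∸ l) + a · (C ⊖ L) + ((μ ∸ k) * (u ∸ l) + _) ∎
  where open ≤-Reasoning

2*⌊n/2⌋≤n : ∀ n → 2 * ⌊ n /2⌋ ≤ n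
2*⌊n/2⌋≤n n = begin
  2 * ⌊ n /2⌋              ≡⟨ cong (⌊ n /2⌋ +_) (+-identityʳ _) ⟩
  ⌊ n /2⌋ + ⌊ n /2⌋        ≤⟨ +-monoʳ-≤ ⌊ n /2⌋ (⌊n/2⌋≤⌈n/2⌉ n) ⟩
  ⌊ n /2⌋ + ⌈ n /2⌉        ≡⟨ ⌊n/2⌋+⌈n/2⌉≡n n ⟩
  n                        ∎
  where open ≤-Reasoning

-- The lower bound

spread : ∀ m → ℕ → Vec ℕ m
spread zero    _       = []
spread (suc m) zero    = 0 ∷ spread m zero
spread (suc m) (suc s) = 1 ∷ spread m s

sum-spread : ∀ {m s} → s ≤ m → sum (spread m s) ≡ s
sum-spread {zero}  z≤n       = refl
sum-spread {suc m} z≤n       = sum-spread {m} z≤n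
sum-spread {suc m} (s≤s s≤m) = cong suc (sum-spread s≤m)

lookup-spread : ∀ m s v → lookup (spread m s) v ≤ 1
lookup-spread (suc m) zero    zero    = z≤n
lookup-spread (suc m) (suc s) zero    = ≤-refl
lookup-spread (suc m) zero    (suc v) = lookup-spread m zero v
lookup-spread (suc m) (suc s) (suc v) = lookup-spread m s v

-- With no pebble on the root and at most one elsewhere, no move is legal.
order≤pebbling : ∀ (G : SimpleGraph n) s → AlwaysSolvable G s → n ≤ s
order≤pebbling {zero}  G s _      = z≤n
order≤pebbling {suc m} G s always with suc m ≤? s
... | yes m<s = m<s
-- As s is below the order `suc m`, the `m` vertices other than the root have room for s pebbles,
-- one each.
... | no  m≮s = contradiction (always zero (0 ∷ spread m s) (sum-spread s≤m)) stuck
  where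
  s≤m : s ≤ m
  s≤m = s≤s⁻¹ (≰⇒> m≮s)

  ≤1 : ∀ u → lookup (0 ∷ spread m s) u ≤ 1
  ≤1 zero    = z≤n
  ≤1 (suc u) = lookup-spread m s u

  stuck : Solvable G zero (0 ∷ spread m s) → _
  stuck (_ , ε , ())
  stuck (_ , move {u = u} _ 2≤ ◅ _ , _) = contradiction (≤-trans 2≤ (≤1 u)) λ { (s≤s ()) }

-- Weight functions and certificates

Arc : ℕ → Set
Arc n = Fin n × Fin n

-- m ∙ as ↝ t stands for the inequality of the tree t with top weight m, applied
-- after the moves as.
record Term (n : ℕ) : Set where
  constructor _∙_↝_
  field
    top   : ℕ
    moves : List (Arc n)
    tree  : List (Arc n)

-- split v k c d distinguishes the cases C(v) ≤ k and C(v) > k.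
data Certificate (n : ℕ) : Set where
  split : Fin n → ℕ → Certificate n → Certificate n → Certificate n
  leaf  : ℕ → List (Term n) → Certificate n

relabel : (Fin n → Fin n) → Certificate n → Certificate n
relabel σ (split v k c d) = split (σ v) k (relabel σ c) (relabel σ d)
relabel {n} σ (leaf μ ts) = leaf μ (List.map term ts)
  where
  arc : Arc n → Arc n
  arc (u , v) = σ u , σ v

  term : Term n → Term n
  term (m ∙ as ↝ t) = m ∙ List.map arc as ↝ List.map arc t

module Pebbling (n : ℕ) (G : SimpleGraph n) (adj? : Decidable (Adj G)) (r : Fin n) where

  Star-solvable : ∀ {C D} → Star (Move G) C D → Solvable G r D → Solvable G r C
  Star-solvable ms (E , ms′ , 1≤) = E , ms ◅◅ ms′ , 1≤

  Move-⊕ : ∀ {C D} R → Move G C D → Move G (C ⊕ R) (D ⊕ R)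
  Move-⊕ R (move {C} {u} {v} uv 2≤) =
    subst (Move G (C ⊕ R))
      (trans (cong (λ D → updateAt D v suc) (updateAt-⊕-∸2 C R u 2≤))
             (updateAt-⊕-suc (updateAt C u (_∸ 2)) R v))
      (move uv (≤-trans 2≤ (lookup-⊕-≤ C R u)))

  -- For an unsolvable C this is the inequality  w · C ≤ w · 1.
  IsWeightFunction : Vec ℕ n → Set
  IsWeightFunction w = ∀ C → sum w < w · C → Solvable G r C

  zero-isWeightFunction : IsWeightFunction (replicate n 0)
  zero-isWeightFunction C 0<0 =
    contradiction (≤-trans 0<0 (≤-trans (≤-reflexive (·-zeroˡ C)) z≤n)) (<-irrefl refl)

  -- Moves from u to p do not decrease the weight, and they can be made until
  -- at most one pebble is left on u, whose contribution k is within budget.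
  attach-isWeightFunction :
    ∀ w u p k → IsWeightFunction w → lookup w u ≡ 0 → Adj G u p →
    p ≡ r ⊎ 2 * k ≤ lookup w p → IsWeightFunction (w [ u ]≔ k)
  attach-isWeightFunction w u p k wf wu≡0 up heavy C = go heavy (lookup C u) C ≤-refl
    where
    open ≤-Reasoning
    w′ = w [ u ]≔ k

    p≢u : p ≢ u
    p≢u refl = loopless G u up

    -- Recursion on an upper bound `m` for the pebbles on `u`; a move takes two of them, so the
    -- bound drops.
    go : p ≡ r ⊎ 2 * k ≤ lookup w p →
         ∀ m C → lookup C u ≤ m → sum w′ < w′ · C → Solvable G r C
    go heavy m C Cu≤m lt with 2 ≤? lookup C u
    go heavy m C Cu≤m lt | no 2≰Cu = wf C (+-cancelˡ-< k _ _ (begin-strict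
      k + sum w               ≡⟨ sum-[]≔ w u k wu≡0 ⟨
      sum w′                  <⟨ lt ⟩
      w′ · C                  ≡⟨ ·-[]≔ w C u k wu≡0 ⟩
      k * lookup C u + w · C  ≤⟨ +-monoˡ-≤ (w · C) (*-monoʳ-≤ k (s≤s⁻¹ (≰⇒> 2≰Cu))) ⟩
      k * 1 + w · C           ≡⟨ cong (_+ w · C) (*-identityʳ k) ⟩
      k + w · C               ∎))
    go heavy zero C Cu≤m lt | yes 2≤Cu = contradiction (≤-trans 2≤Cu Cu≤m) λ ()
    -- If the parent is the root, a single move already solves `C`; hence the weight `k` of a
    -- neighbour of the root is arbitrary.
    go (inj₁ refl) (suc m) C Cu≤m lt | yes 2≤Cu =
      _ , move up 2≤Cu ◅ ε ,
      ≤-trans (s≤s z≤n) (≤-reflexive (sym (lookup∘updateAt p (updateAt C u (_∸ 2)))))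
    go (inj₂ 2k≤wp) (suc m) C Cu≤m lt | yes 2≤Cu =
      Star-solvable (move up 2≤Cu ◅ ε) (go (inj₂ 2k≤wp) m D Du≤m (<-≤-trans lt w′C≤w′D))
      where
      C₋ = updateAt C u (_∸ 2)
      D  = updateAt C₋ p suc

      Du≤m : lookup D u ≤ m
      Du≤m = begin
        lookup D u         ≡⟨ lookup∘updateAt′ u p (p≢u ∘ sym) C₋ ⟩
        lookup C₋ u        ≡⟨ lookup∘updateAt u C ⟩
        lookup C u ∸ 2     ≤⟨ ∸-monoˡ-≤ 2 Cu≤m ⟩
        suc m ∸ 2          ≤⟨ m∸n≤m m 1 ⟩
        m                  ∎

      w′C≤w′D : w′ · C ≤ w′ · D
      w′C≤w′D = begin
        w′ · C                      ≡⟨ ·-∸2 w′ C u 2≤Cu ⟨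
        2 * lookup w′ u + w′ · C₋   ≡⟨ cong (λ x → 2 * x + w′ · C₋) (lookup∘update u w k) ⟩
        2 * k + w′ · C₋             ≤⟨ +-monoˡ-≤ (w′ · C₋) 2k≤wp ⟩
        lookup w p + w′ · C₋        ≡⟨ cong (_+ w′ · C₋) (lookup∘update′ p≢u w k) ⟨
        lookup w′ p + w′ · C₋       ≡⟨ ·-suc w′ C₋ p ⟨
        w′ · D                      ∎

  attach : ℕ → Arc n → Vec ℕ n → Vec ℕ n
  attach m (u , p) w = w [ u ]≔ (if does (p ≟ r) then m else ⌊ lookup w p /2⌋)

  -- The arcs of a tree point to the root r and are listed leaves first; the
  -- neighbours of r get weight m, and weights halve, rounded down, away from r.
  weight : ℕ → List (Arc n) → Vec ℕ n
  weight m []       = replicate n 0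
  weight m (a ∷ as) = attach m a (weight m as)

  -- That `u` is new is read off from its weight being 0. A parent other than `r` that has not been
  -- attached has weight 0 and passes on 0, so the inequality stays sound.
  IsTree : ℕ → List (Arc n) → Set
  IsTree m []             = ⊤
  IsTree m ((u , p) ∷ as) = Adj G u p × lookup (weight m as) u ≡ 0 × IsTree m as

  isTree? : ∀ m as → Dec (IsTree m as)
  isTree? m []             = yes tt
  isTree? m ((u , p) ∷ as) = adj? u p ×-dec (lookup (weight m as) u ≟ℕ 0) ×-dec isTree? m as

  tree-isWeightFunction : ∀ m as → IsTree m as → IsWeightFunction (weight m as)
  tree-isWeightFunction m []             _                = zero-isWeightFunction
  tree-isWeightFunction m ((u , p) ∷ as) (up , fresh , t) with p ≟ r
  ... | yes p≡r = attach-isWeightFunction (weight m as) u p m (tree-isWeightFunction m as t)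
                    fresh up (inj₁ p≡r)
  ... | no  _   = attach-isWeightFunction w u p ⌊ lookup w p /2⌋ (tree-isWeightFunction m as t)
                    fresh up (inj₂ (2*⌊n/2⌋≤n (lookup w p)))
    where w = weight m as

  -- Tree inequalities after preliminary moves, and their sums.

  run : List (Arc n) → Configuration n → Configuration n
  run []             C = C
  run ((u , v) ∷ as) C = run as (updateAt (updateAt C u (_∸ 2)) v suc)

  Legal : List (Arc n) → Configuration n → Set
  Legal []             C = ⊤
  Legal ((u , v) ∷ as) C =
    Adj G u v × 2 ≤ lookup C u × Legal as (updateAt (updateAt C u (_∸ 2)) v suc)

  legal? : ∀ as C → Dec (Legal as C)
  legal? []             C = yes tt
  legal? ((u , v) ∷ as) C = adj? u v ×-dec (2 ≤? lookup C u) ×-dec legal? as _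

  -- When `C` is the lower corner of a box, the moves are paid for by its pebbles alone, so one
  -- legality check covers every configuration of the box.
  run-⊕ : ∀ as C R → Legal as C → Star (Move G) (C ⊕ R) (run as C ⊕ R)
  run-⊕ []       C R _             = ε
  run-⊕ (_ ∷ as) C R (uv , 2≤ , l) = Move-⊕ R (move uv 2≤) ◅ run-⊕ as _ R l

  ValidTerm : Configuration n → Term n → Set
  ValidTerm L (m ∙ as ↝ t) = Legal as L × IsTree m t

  validTerm? : ∀ L t → Dec (ValidTerm L t)
  validTerm? L (m ∙ as ↝ t) = legal? as L ×-dec isTree? m t

  coefficients : List (Term n) → Vec ℕ n
  coefficients []                  = replicate n 0
  coefficients ((m ∙ _ ↝ t) ∷ ts) = weight m t ⊕ coefficients ts

  -- The constant part of the summed inequalities: after its moves a term weighs `run as L ⊕ R`, and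
  -- the share of `run as L` is a known number.
  gain : Configuration n → List (Term n) → ℕ
  gain L []                   = 0
  gain L ((m ∙ as ↝ t) ∷ ts) = weight m t · run as L + gain L ts

  -- Either some tree inequality is violated after its moves, and its weight function yields a
  -- solution, or all of them hold and can be added.
  combine : ∀ L R ts → All (ValidTerm L) ts →
            Solvable G r (L ⊕ R) ⊎
            coefficients ts · R + gain L ts ≤ sum (coefficients ts)
  combine L R []                   []                = inj₂ (≤-trans (≤-reflexive eq) z≤n)
    where
    eq : replicate n 0 · R + 0 ≡ 0
    eq = trans (+-identityʳ _) (·-zeroˡ R)
  combine L R ((m ∙ as ↝ t) ∷ ts) ((legal , tree) ∷ valid)
    with sum (weight m t) <? weight m t · (run as L ⊕ R) | combine L R ts valid
  ... | yes lt | _       = inj₁ (Star-solvable (run-⊕ as L R legal)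
                                         (tree-isWeightFunction m t tree _ lt))
  ... | no  _  | inj₁ s  = inj₁ s
  ... | no ≮   | inj₂ le = inj₂ (begin
    (w ⊕ c) · R + (w · run as L + gain L ts)      ≡⟨ cong (_+ _) (·-⊕ˡ w c R) ⟩
    w · R + c · R + (w · run as L + gain L ts)    ≡⟨ eq (w · R) (c · R) (w · run as L) (gain L ts) ⟩
    w · run as L + w · R + (c · R + gain L ts)    ≡⟨ cong (_+ _) (·-⊕ʳ w (run as L) R) ⟨
    w · (run as L ⊕ R) + (c · R + gain L ts)      ≤⟨ +-mono-≤ (≮⇒≥ ≮) le ⟩
    sum w + sum c                                 ≡⟨ sum-⊕ w c ⟨
    sum (w ⊕ c)                                   ∎)
    where
    open ≤-Reasoning
    w = weight m t
    c = coefficients ts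
    eq : ∀ p q s t → p + q + (s + t) ≡ s + p + (q + t)
    eq = solve-∀

  -- In the box L ≤ C ≤ U the terms of a leaf give a linear bound with coefficients
  -- a; where a(v) < μ, the bound C(v) ≤ U(v) makes up the difference, so that μ
  -- times the number of pebbles is bounded.
  Valid : ℕ → (L U : Configuration n) → Certificate n → Set
  Valid t L U (split v k c d) = Valid t L (U [ v ]≔ k) c × Valid t (L [ v ]≔ suc k) U d
  Valid t L U (leaf μ ts)     =
    All (ValidTerm L) ts ×
    sum a + (replicate n μ ⊖ a) · (U ⊖ L) < μ * (t ∸ sum L) + gain L ts
    where a = coefficients ts

  valid? : ∀ t L U c → Dec (Valid t L U c)
  valid? t L U (split v k c d) = valid? t L (U [ v ]≔ k) c ×-dec valid? t (L [ v ]≔ suc k) U d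
  valid? t L U (leaf μ ts)     = all? (validTerm? L) ts ×-dec (_ <? _)

  -- Soundness of certificates.

  private
    _≼_ : Configuration n → Configuration n → Set
    C ≼ D = ∀ v → lookup C v ≤ lookup D v

    ≔-≼ : ∀ L C v {k} → L ≼ C → k ≤ lookup C v → (L [ v ]≔ k) ≼ C
    ≔-≼ L C v {k} L≼C k≤ i with i ≟ v
    ... | yes refl = ≤-trans (≤-reflexive (lookup∘update v L k)) k≤
    ... | no  i≢v  = ≤-trans (≤-reflexive (lookup∘update′ i≢v L k)) (L≼C i)

    ≼-≔ : ∀ C U v {k} → C ≼ U → lookup C v ≤ k → C ≼ (U [ v ]≔ k)
    ≼-≔ C U v {k} C≼U ≤k i with i ≟ v
    ... | yes refl = ≤-trans ≤k (≤-reflexive (sym (lookup∘update v U k)))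
    ... | no  i≢v  = ≤-trans (C≼U i) (≤-reflexive (sym (lookup∘update′ i≢v U k)))

  -- The splits are followed to the leaf whose box contains `C`. There `C` is the guaranteed part
  -- `L` plus an excess `R`; if no term solves `C`, the summed inequality for `R` contradicts the
  -- numerical condition of the leaf.
  valid⇒solvable : ∀ c {L U C} → Valid (sum C) L U c → L ≼ C → C ≼ U → Solvable G r C
  valid⇒solvable (split v k c d) {L} {U} {C} (vc , vd) L≼C C≼U with lookup C v ≤? k
  ... | yes ≤k = valid⇒solvable c vc L≼C (≼-≔ C U v C≼U ≤k)
  ... | no  ≰k = valid⇒solvable d vd (≔-≼ L C v L≼C (≰⇒> ≰k)) C≼U
  valid⇒solvable (leaf μ ts) {L} {U} {C} (terms , lt) L≼C C≼U with combine L (C ⊖ L) ts terms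
  ... | inj₁ s  = subst (Solvable G r) (⊕-⊖ L C L≼C) s
  ... | inj₂ le = contradiction (begin-strict
    sum a + b                               <⟨ lt ⟩
    μ * (sum C ∸ sum L) + gain L ts         ≡⟨ cong (λ s → μ * s + gain L ts) sum-R ⟩
    μ * sum R + gain L ts                   ≤⟨ +-monoˡ-≤ (gain L ts) (scaled-sum-≤ μ a L U C C≼U) ⟩
    a · R + b + gain L ts                   ≡⟨ xy∙z≈xz∙y (a · R) b (gain L ts) ⟩
    a · R + gain L ts + b                   ≤⟨ +-monoˡ-≤ b le ⟩
    sum a + b                               ∎) (<-irrefl refl)
    where
    open ≤-Reasoning
    a = coefficients ts
    R = C ⊖ L
    b = (replicate n μ ⊖ a) · (U ⊖ L)

    sum-R : sum C ∸ sum L ≡ sum R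
    sum-R = trans (cong (_∸ sum L) (trans (cong sum (sym (⊕-⊖ L C L≼C))) (sum-⊕ L R)))
                  (m+n∸m≡n (sum L) (sum R))

  -- A pebble on `r` is a solution without moves. Otherwise `C` lies in the initial box, where `r`
  -- is empty and no vertex exceeds the total `t`.
  certified : ∀ t c → Valid t (replicate n 0) (replicate n t [ r ]≔ 0) c →
              ∀ C → sum C ≡ t → Solvable G r C
  certified _ c valid C refl with 1 ≤? lookup C r
  ... | yes 1≤Cr = C , ε , 1≤Cr
  ... | no  1≰Cr = valid⇒solvable c valid 0≼C (≼-≔ C (replicate n (sum C)) r C≼t (s≤s⁻¹ (≰⇒> 1≰Cr)))
    where
    0≼C : replicate n 0 ≼ C
    0≼C v = ≤-trans (≤-reflexive (lookup-replicate v 0)) z≤n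

    C≼t : C ≼ replicate n (sum C)
    C≼t v = ≤-trans (lookup≤sum C v) (≤-reflexive (sym (lookup-replicate v (sum C))))

-- Certificates for J₃

-- The multipliers are rounded dual solutions of the linear programmes that
-- maximise the number of pebbles in each box.
certificate-x₀ : Certificate 12
certificate-x₀ =
  (split x₁ 0
    (split y₁ 0
      (leaf 282
        ((64 ∙ [] ↝ t₁) ∷ (424 ∙ [] ↝ t₂) ∷ (98 ∙ [] ↝ t₃) ∷ (112 ∙ [] ↝ t₄) ∷
         (232 ∙ [] ↝ t₅) ∷ (420 ∙ [] ↝ t₆) ∷ []))
      (split v₀ 1
        (split z₁ 1
          (split v₁ 3
            (split v₋₁ 1
              (leaf 56 ((56 ∙ [] ↝ t₇) ∷ (80 ∙ [] ↝ t₈) ∷ (8 ∙ [] ↝ t₄) ∷ (36 ∙ [] ↝ t₅) ∷ []))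
              (split z₋₁ 0
                (split v₋₁ 3
                  (leaf 16 ((32 ∙ [] ↝ t₉) ∷ (8 ∙ [] ↝ t₄) ∷ (16 ∙ [] ↝ t₁₀) ∷ []))
                  (leaf 24
                    ((48 ∙ [] ↝ t₉) ∷ (8 ∙ [] ↝ t₄) ∷ (32 ∙ [] ↝ t₁₀) ∷
                     -- The four pebbles guaranteed on `v₋₁` weigh only 12 in `t₁₁`; the shortcut
                     -- through `z₋₁` turns them into one pebble on `x₋₁`, of weight 48.
                     (48 ∙ ((v₋₁ , z₋₁) ∷ (v₋₁ , z₋₁) ∷ (z₋₁ , x₋₁) ∷ []) ↝ t₁₁) ∷ [])))
                (leaf 22
                  ((40 ∙ [] ↝ t₇) ∷ (32 ∙ [] ↝ t₁₀) ∷ (8 ∙ [] ↝ t₅) ∷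
                   (48 ∙ ((v₋₁ , z₋₁) ∷ (z₋₁ , x₋₁) ∷ []) ↝ t₁₁) ∷ []))))
            (split v₀ 0
              (leaf 88
                ((100 ∙ [] ↝ t₉) ∷ (64 ∙ [] ↝ t₃) ∷ (96 ∙ [] ↝ t₄) ∷
                 (60 ∙ ((v₁ , v₀) ∷ (v₁ , v₀) ∷ (v₀ , z₀) ∷ []) ↝ t₁₂) ∷ (16 ∙ [] ↝ t₁₁) ∷
                 (168 ∙ ((v₁ , z₁) ∷ (v₁ , z₁) ∷ (z₁ , y₁) ∷ (y₁ , x₋₁) ∷ []) ↝ t₆) ∷ []))
              (leaf 136
                ((320 ∙ [] ↝ t₁) ∷ (64 ∙ [] ↝ t₄) ∷ (64 ∙ [] ↝ t₁₀) ∷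
                 (272 ∙ ((v₁ , v₀) ∷ (v₀ , z₀) ∷ []) ↝ t₁₃) ∷
                 (128 ∙ ((v₁ , z₁) ∷ (v₁ , z₁) ∷ (z₁ , y₁) ∷ (y₁ , x₋₁) ∷ []) ↝ t₆) ∷ []))))
          (leaf 7
            ((8 ∙ [] ↝ t₉) ∷ (17 ∙ [] ↝ t₃) ∷ (10 ∙ ((z₁ , x₁) ∷ []) ↝ t₁₄) ∷
             (8 ∙ ((z₁ , y₁) ∷ (y₁ , x₋₁) ∷ []) ↝ t₆) ∷ [])))
        (leaf 12
          ((16 ∙ ((v₀ , v₋₁) ∷ []) ↝ t₈) ∷ (32 ∙ [] ↝ t₁) ∷ (4 ∙ ((v₀ , v₁) ∷ []) ↝ t₄) ∷
           (16 ∙ ((v₀ , z₀) ∷ []) ↝ t₁₃) ∷ []))))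
    (leaf 15 ((20 ∙ [] ↝ t₉) ∷ (32 ∙ [] ↝ t₃) ∷ (20 ∙ [] ↝ t₁₄) ∷ (16 ∙ [] ↝ t₆) ∷ [])))
  where
  t₁ t₂ t₃ t₄ t₅ t₆ t₇ t₈ t₉ t₁₀ t₁₁ t₁₂ t₁₃ t₁₄ : List (Arc 12)
  t₁ = (y₁ , z₁) ∷ (y₋₁ , z₋₁) ∷ (z₁ , v₁) ∷ (z₋₁ , v₋₁) ∷ (v₁ , v₀) ∷ (v₋₁ , v₀) ∷ (v₀ , z₀) ∷ (z₀ , x₀) ∷ []
  t₂ = (z₁ , v₁) ∷ (y₋₁ , y₀) ∷ (v₁ , v₀) ∷ (v₋₁ , v₀) ∷ (y₀ , z₀) ∷ (v₀ , z₀) ∷ (z₀ , x₀) ∷ []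
  t₃ = (z₋₁ , v₋₁) ∷ (y₀ , y₁) ∷ (v₀ , v₁) ∷ (v₋₁ , v₁) ∷ (y₁ , z₁) ∷ (v₁ , z₁) ∷ (z₁ , x₁) ∷ (x₁ , x₀) ∷ []
  t₄ = (v₋₁ , v₁) ∷ (y₁ , z₁) ∷ (v₁ , z₁) ∷ (y₋₁ , x₁) ∷ (z₁ , x₁) ∷ (x₁ , x₀) ∷ []
  t₅ = (v₋₁ , v₁) ∷ (y₀ , y₋₁) ∷ (z₋₁ , y₋₁) ∷ (v₁ , z₁) ∷ (y₋₁ , x₁) ∷ (z₁ , x₁) ∷ (x₁ , x₀) ∷ []
  t₆ = (v₀ , v₁) ∷ (v₁ , v₋₁) ∷ (v₋₁ , z₋₁) ∷ (z₋₁ , x₋₁) ∷ (x₋₁ , x₀) ∷ []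
  t₇ = (z₁ , v₁) ∷ (z₋₁ , v₋₁) ∷ (y₁ , y₀) ∷ (y₋₁ , y₀) ∷ (v₁ , v₀) ∷ (v₋₁ , v₀) ∷ (y₀ , z₀) ∷ (v₀ , z₀) ∷ (z₀ , x₀) ∷ []
  t₈ = (v₁ , v₋₁) ∷ (y₀ , y₁) ∷ (y₋₁ , z₋₁) ∷ (z₁ , y₁) ∷ (v₋₁ , z₋₁) ∷ (y₁ , x₋₁) ∷ (z₋₁ , x₋₁) ∷ (x₋₁ , x₀) ∷ []
  t₉ = (z₁ , v₁) ∷ (y₁ , y₀) ∷ (y₋₁ , y₀) ∷ (v₁ , v₀) ∷ (v₋₁ , v₀) ∷ (y₀ , z₀) ∷ (v₀ , z₀) ∷ (z₀ , x₀) ∷ []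
  t₁₀ = (v₁ , v₋₁) ∷ (y₋₁ , z₋₁) ∷ (v₋₁ , z₋₁) ∷ (y₁ , x₋₁) ∷ (z₋₁ , x₋₁) ∷ (x₋₁ , x₀) ∷ []
  t₁₁ = (v₀ , v₁) ∷ (v₋₁ , v₁) ∷ (v₁ , z₁) ∷ (z₁ , y₁) ∷ (y₁ , x₋₁) ∷ (x₋₁ , x₀) ∷ []
  t₁₂ = (y₁ , y₀) ∷ (y₋₁ , y₀) ∷ (y₀ , z₀) ∷ (z₀ , x₀) ∷ []
  t₁₃ = (v₁ , z₁) ∷ (z₁ , y₁) ∷ (y₁ , y₀) ∷ (y₋₁ , y₀) ∷ (y₀ , z₀) ∷ (z₀ , x₀) ∷ []
  t₁₄ = (y₁ , y₀) ∷ (v₋₁ , z₋₁) ∷ (y₀ , y₋₁) ∷ (z₋₁ , y₋₁) ∷ (y₋₁ , x₁) ∷ (x₁ , x₀) ∷ []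

certificate-z₀ : Certificate 12
certificate-z₀ =
  (split v₋₁ 0
    (leaf 214
      ((102 ∙ [] ↝ t₁) ∷ (272 ∙ [] ↝ t₂) ∷ (162 ∙ [] ↝ t₃) ∷ (172 ∙ [] ↝ t₄) ∷
       (128 ∙ [] ↝ t₅) ∷ (16 ∙ [] ↝ t₆) ∷ (16 ∙ [] ↝ t₇) ∷ []))
    (split y₁ 0
      (leaf 104
        ((96 ∙ [] ↝ t₁) ∷ (32 ∙ [] ↝ t₈) ∷ (176 ∙ [] ↝ t₄) ∷ (52 ∙ [] ↝ t₅) ∷
         (72 ∙ [] ↝ t₆) ∷ (24 ∙ [] ↝ t₇) ∷ []))
      (split z₋₁ 4
        (split z₁ 1
          (leaf 208
            ((256 ∙ [] ↝ t₁) ∷ (128 ∙ [] ↝ t₂) ∷ (80 ∙ [] ↝ t₈) ∷ (28 ∙ [] ↝ t₉) ∷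
             (320 ∙ [] ↝ t₃) ∷ (16 ∙ [] ↝ t₅) ∷ []))
          (leaf 154
            ((152 ∙ [] ↝ t₁) ∷ (40 ∙ [] ↝ t₂) ∷ (96 ∙ [] ↝ t₈) ∷ (256 ∙ [] ↝ t₃) ∷
             (56 ∙ [] ↝ t₅) ∷ (32 ∙ ((z₁ , y₁) ∷ (y₁ , y₀) ∷ []) ↝ t₆) ∷ [])))
        (leaf 31
          -- The box guarantees five pebbles on `z₋₁` and one on `v₋₁`, both outside `t₁₀`; the
          -- moves carry them onto the tree, with one pebble arriving at `v₀` and one at `y₋₁`.
          ((48 ∙ [] ↝ t₁) ∷ (50 ∙ ((z₋₁ , v₋₁) ∷ (z₋₁ , y₋₁) ∷ (v₋₁ , v₀) ∷ []) ↝ t₁₀) ∷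
           (28 ∙ [] ↝ t₈) ∷ (50 ∙ [] ↝ t₉) ∷ (4 ∙ [] ↝ t₆) ∷ [])))))
  where
  t₁ t₂ t₃ t₄ t₅ t₆ t₇ t₈ t₉ t₁₀ : List (Arc 12)
  t₁ = (v₁ , z₁) ∷ (v₋₁ , z₋₁) ∷ (y₁ , x₋₁) ∷ (y₋₁ , x₁) ∷ (z₁ , x₁) ∷ (z₋₁ , x₋₁) ∷ (x₁ , x₀) ∷ (x₋₁ , x₀) ∷ (x₀ , z₀) ∷ []
  t₂ = (v₁ , z₁) ∷ (x₁ , y₋₁) ∷ (x₋₁ , y₁) ∷ (z₁ , y₁) ∷ (z₋₁ , y₋₁) ∷ (y₁ , y₀) ∷ (y₋₁ , y₀) ∷ (y₀ , z₀) ∷ []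
  t₃ = (x₋₁ , y₁) ∷ (x₁ , z₁) ∷ (y₁ , z₁) ∷ (y₋₁ , z₋₁) ∷ (z₁ , v₁) ∷ (z₋₁ , v₋₁) ∷ (v₁ , v₀) ∷ (v₋₁ , v₀) ∷ (v₀ , z₀) ∷ []
  t₄ = (x₋₁ , z₋₁) ∷ (y₋₁ , z₋₁) ∷ (z₁ , v₁) ∷ (z₋₁ , v₋₁) ∷ (v₁ , v₀) ∷ (v₋₁ , v₀) ∷ (v₀ , z₀) ∷ []
  t₅ = (v₋₁ , z₋₁) ∷ (y₁ , x₋₁) ∷ (z₁ , x₁) ∷ (z₋₁ , x₋₁) ∷ (x₁ , x₀) ∷ (x₋₁ , x₀) ∷ (x₀ , z₀) ∷ []
  t₆ = (y₁ , z₁) ∷ (v₁ , z₁) ∷ (z₁ , x₁) ∷ (x₁ , y₋₁) ∷ (z₋₁ , y₋₁) ∷ (y₋₁ , y₀) ∷ (y₀ , z₀) ∷ []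
  t₇ = (z₋₁ , y₋₁) ∷ (y₋₁ , x₁) ∷ (z₁ , x₁) ∷ (x₁ , x₀) ∷ (x₀ , z₀) ∷ []
  t₈ = (x₋₁ , y₁) ∷ (z₁ , y₁) ∷ (z₋₁ , y₋₁) ∷ (y₁ , y₀) ∷ (y₋₁ , y₀) ∷ (y₀ , z₀) ∷ []
  t₉ = (z₋₁ , v₋₁) ∷ (v₋₁ , v₀) ∷ (v₀ , z₀) ∷ []
  t₁₀ = (y₋₁ , x₁) ∷ (x₁ , z₁) ∷ (y₁ , z₁) ∷ (z₁ , v₁) ∷ (v₁ , v₀) ∷ (v₀ , z₀) ∷ []

certificate-v₀ : Certificate 12
certificate-v₀ =
  (split x₀ 1
    (split z₁ 2
      (split z₀ 0
        (split y₀ 1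
          (split z₋₁ 2
            (split y₋₁ 0
              (split x₋₁ 2
                (leaf 92
                  ((16 ∙ [] ↝ t₁) ∷ (128 ∙ [] ↝ t₂) ∷ (176 ∙ [] ↝ t₃) ∷ (32 ∙ [] ↝ t₄) ∷
                   (96 ∙ [] ↝ t₅) ∷ []))
                (split x₁ 2
                  (leaf 84
                    ((112 ∙ [] ↝ t₂) ∷ (160 ∙ [] ↝ t₃) ∷ (32 ∙ [] ↝ t₄) ∷ (112 ∙ [] ↝ t₅) ∷
                     []))
                  (leaf 32
                    ((32 ∙ [] ↝ t₁) ∷ (48 ∙ [] ↝ t₃) ∷ (64 ∙ [] ↝ t₄) ∷
                     (48 ∙ ((x₁ , x₀) ∷ (x₋₁ , x₀) ∷ (x₀ , z₀) ∷ []) ↝ t₆) ∷ []))))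
              (split v₋₁ 0
                (split v₁ 0
                  (split y₀ 0
                    (split z₁ 1
                      (split z₋₁ 1
                        (split y₋₁ 3
                          (split x₀ 0
                            (split x₋₁ 4
                              (split x₁ 1
                                (leaf 8 ((16 ∙ [] ↝ t₇) ∷ (16 ∙ [] ↝ t₁) ∷ (8 ∙ [] ↝ t₈) ∷ []))
                                (split y₋₁ 2
                                  (leaf 12
                                    ((32 ∙ [] ↝ t₇) ∷ (16 ∙ [] ↝ t₁) ∷ (8 ∙ [] ↝ t₉) ∷
                                     (8 ∙ ((x₁ , y₋₁) ∷ []) ↝ t₁₀) ∷ []))
                                  (leaf 8
                                    ((24 ∙ [] ↝ t₇) ∷
                                     (5 ∙ ((x₁ , y₋₁) ∷ (y₋₁ , y₀) ∷ (y₋₁ , y₀) ∷ (y₀ , z₀) ∷ []) ↝ t₄) ∷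
                                     (16 ∙ ((x₁ , y₋₁) ∷ (y₋₁ , z₋₁) ∷ (y₋₁ , z₋₁) ∷ []) ↝ t₅) ∷
                                     []))))
                              (leaf 17
                                ((24 ∙ [] ↝ t₇) ∷ (32 ∙ [] ↝ t₁) ∷
                                 (24 ∙ ((x₋₁ , x₀) ∷ (x₋₁ , x₀) ∷ (x₀ , z₀) ∷ []) ↝ t₁₁) ∷
                                 (16 ∙ [] ↝ t₄) ∷ [])))
                            (split y₁ 3
                              (split x₁ 1
                                (split x₋₁ 1
                                  -- Without terms the condition says that the upper bounds of the
                                  -- box add up to less than 12; here they add up to 11.
                                  (leaf 1 ([]))
                                  (leaf 3
                                    ((8 ∙ ((x₋₁ , x₀) ∷ (x₀ , z₀) ∷ []) ↝ t₁₁) ∷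
                                     (8 ∙ [] ↝ t₉) ∷ [])))
                                (leaf 3
                                  ((8 ∙ ((x₁ , x₀) ∷ (x₀ , z₀) ∷ []) ↝ t₁₁) ∷ (8 ∙ [] ↝ t₉) ∷
                                   [])))
                              (leaf 3
                                ((16 ∙ ((y₁ , y₀) ∷ (y₁ , y₀) ∷ (y₀ , z₀) ∷ []) ↝ t₁₂) ∷
                                 (16 ∙ ((y₁ , y₀) ∷ (y₁ , y₀) ∷ (y₀ , z₀) ∷ []) ↝ t₁₃) ∷
                                 []))))
                          (split x₀ 0
                            (leaf 8
                              ((16 ∙ [] ↝ t₇) ∷ (16 ∙ [] ↝ t₁) ∷
                               (8 ∙ ((y₋₁ , y₀) ∷ (y₋₁ , y₀) ∷ (y₀ , z₀) ∷ []) ↝ t₉) ∷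
                               (4 ∙ [] ↝ t₈) ∷ []))
                            (leaf 3
                              ((16 ∙ ((y₋₁ , y₀) ∷ (y₋₁ , y₀) ∷ (y₀ , z₀) ∷ []) ↝ t₁₂) ∷
                               (16 ∙ ((y₋₁ , y₀) ∷ (y₋₁ , y₀) ∷ (y₀ , z₀) ∷ []) ↝ t₁₃) ∷
                               []))))
                        (leaf 8
                          ((16 ∙ ((z₋₁ , y₋₁) ∷ []) ↝ t₇) ∷ (24 ∙ [] ↝ t₁) ∷
                           (4 ∙ ((z₋₁ , y₋₁) ∷ (y₋₁ , y₀) ∷ []) ↝ t₂) ∷ [])))
                      (leaf 20
                        ((56 ∙ [] ↝ t₇) ∷ (8 ∙ ((z₁ , x₁) ∷ []) ↝ t₉) ∷ (16 ∙ [] ↝ t₁₄) ∷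
                         (40 ∙ ((z₁ , y₁) ∷ []) ↝ t₁₀) ∷ [])))
                    (split z₋₁ 1
                      (split y₁ 1
                        (split y₋₁ 1
                          (split x₁ 1
                            (split x₋₁ 3
                              (leaf 1 ([]))
                              (split y₁ 0
                                (leaf 8 ((16 ∙ [] ↝ t₁₅) ∷ (16 ∙ [] ↝ t₁₆) ∷ []))
                                (leaf 2
                                  ((8 ∙ ((x₋₁ , y₁) ∷ (y₁ , y₀) ∷ (y₀ , z₀) ∷ []) ↝ t₄) ∷
                                   []))))
                            (leaf 2
                              ((8 ∙ ((x₁ , y₋₁) ∷ (y₋₁ , y₀) ∷ (y₀ , z₀) ∷ []) ↝ t₄) ∷ [])))
                          (leaf 35
                            ((32 ∙ [] ↝ t₇) ∷ (72 ∙ [] ↝ t₁₁) ∷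
                             (72 ∙ ((y₋₁ , y₀) ∷ (y₀ , z₀) ∷ []) ↝ t₁₅) ∷ (16 ∙ [] ↝ t₁₆) ∷
                             [])))
                        (leaf 19
                          ((16 ∙ [] ↝ t₇) ∷ (8 ∙ ((y₁ , y₀) ∷ (y₀ , z₀) ∷ []) ↝ t₁₂) ∷
                           (56 ∙ [] ↝ t₁₁) ∷ (32 ∙ ((y₁ , y₀) ∷ (y₀ , z₀) ∷ []) ↝ t₁₅) ∷ [])))
                      (leaf 65
                        ((96 ∙ ((z₋₁ , y₋₁) ∷ []) ↝ t₇) ∷ (68 ∙ ((z₋₁ , y₋₁) ∷ []) ↝ t₁₁) ∷
                         (100 ∙ ((z₋₁ , y₋₁) ∷ (y₋₁ , y₀) ∷ (y₀ , z₀) ∷ []) ↝ t₉) ∷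
                         (32 ∙ ((z₋₁ , y₋₁) ∷ (y₋₁ , y₀) ∷ (y₀ , z₀) ∷ []) ↝ t₁₃) ∷
                         (80 ∙ [] ↝ t₁₆) ∷ []))))
                  (split z₋₁ 0
                    (leaf 4 ((8 ∙ [] ↝ t₇) ∷ (8 ∙ [] ↝ t₁₇) ∷ (4 ∙ [] ↝ t₁₀) ∷ []))
                    (split x₁ 0
                      (leaf 3 ((8 ∙ [] ↝ t₇) ∷ (8 ∙ [] ↝ t₁₀) ∷ []))
                      (split x₋₁ 4
                        (split y₋₁ 1
                          (leaf 5 ((8 ∙ [] ↝ t₁) ∷ (16 ∙ [] ↝ t₃) ∷ []))
                          (leaf 4
                            ((16 ∙ ((y₋₁ , x₁) ∷ (x₁ , z₁) ∷ []) ↝ t₁₈) ∷ (16 ∙ [] ↝ t₁₄) ∷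
                             (4 ∙ [] ↝ t₁₀) ∷ [])))
                        (leaf 2
                          ((8 ∙ ((x₋₁ , z₋₁) ∷ (z₋₁ , y₋₁) ∷ (y₋₁ , x₁) ∷ (x₁ , z₁) ∷ []) ↝ t₁₈) ∷
                           (16 ∙ ((x₋₁ , y₁) ∷ (x₋₁ , y₁) ∷ (y₁ , z₁) ∷ []) ↝ t₁₄) ∷ []))))))
                (split x₁ 3
                  (split y₁ 1
                    (leaf 8 ((16 ∙ [] ↝ t₇) ∷ (24 ∙ [] ↝ t₁) ∷ []))
                    (split y₀ 0
                      (leaf 2 ((4 ∙ [] ↝ t₇) ∷ (8 ∙ [] ↝ t₁) ∷ []))
                      (leaf 4
                        ((8 ∙ [] ↝ t₇) ∷ (8 ∙ ((y₁ , y₀) ∷ (y₀ , z₀) ∷ []) ↝ t₉) ∷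
                         (8 ∙ [] ↝ t₁₀) ∷ []))))
                  (leaf 3
                    ((4 ∙ ((x₁ , z₁) ∷ (x₁ , z₁) ∷ []) ↝ t₁₈) ∷
                     (16 ∙ ((x₁ , y₋₁) ∷ (y₋₁ , z₋₁) ∷ []) ↝ t₅) ∷ (16 ∙ [] ↝ t₁₉) ∷ [])))))
            (leaf 4 ((4 ∙ [] ↝ t₃) ∷ (24 ∙ [] ↝ t₅) ∷ (16 ∙ [] ↝ t₁₉) ∷ [])))
          (leaf 1252
            ((1960 ∙ ((y₀ , y₋₁) ∷ []) ↝ t₁) ∷ (2192 ∙ [] ↝ t₁₁) ∷ (400 ∙ [] ↝ t₃) ∷
             (1176 ∙ ((y₀ , z₀) ∷ []) ↝ t₁₃) ∷ (1328 ∙ ((y₀ , z₀) ∷ []) ↝ t₄) ∷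
             (852 ∙ [] ↝ t₁₈) ∷ (56 ∙ ((y₀ , y₋₁) ∷ []) ↝ t₁₉) ∷ [])))
        (leaf 8 ((8 ∙ [] ↝ t₇) ∷ (16 ∙ [] ↝ t₁₁) ∷ (16 ∙ [] ↝ t₄) ∷ (12 ∙ [] ↝ t₁₀) ∷ [])))
      (leaf 16
        ((48 ∙ [] ↝ t₁₈) ∷ (72 ∙ [] ↝ t₁₄) ∷ (16 ∙ ((z₁ , y₁) ∷ []) ↝ t₆) ∷ (16 ∙ [] ↝ t₁₆) ∷
         [])))
    (leaf 2324
      ((840 ∙ ((x₀ , x₁) ∷ []) ↝ t₇) ∷ (4160 ∙ ((x₀ , z₀) ∷ []) ↝ t₁₁) ∷
       (1488 ∙ ((x₀ , x₁) ∷ []) ↝ t₃) ∷ (1888 ∙ [] ↝ t₁₃) ∷ (2760 ∙ [] ↝ t₄) ∷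
       (2828 ∙ ((x₀ , x₋₁) ∷ []) ↝ t₁₀) ∷ (480 ∙ ((x₀ , x₁) ∷ []) ↝ t₁₉) ∷
       (464 ∙ ((x₀ , x₋₁) ∷ []) ↝ t₁₆) ∷ [])))
  where
  t₁ t₂ t₃ t₄ t₅ t₆ t₇ t₈ t₉ t₁₀ t₁₁ t₁₂ t₁₃ t₁₄ t₁₅ t₁₆ t₁₇ t₁₈ t₁₉ : List (Arc 12)
  t₁ = (x₁ , y₋₁) ∷ (y₁ , x₋₁) ∷ (x₋₁ , z₋₁) ∷ (y₋₁ , z₋₁) ∷ (z₋₁ , v₋₁) ∷ (v₋₁ , v₀) ∷ []
  t₂ = (z₋₁ , x₋₁) ∷ (x₁ , x₀) ∷ (x₋₁ , x₀) ∷ (y₁ , y₀) ∷ (x₀ , z₀) ∷ (y₀ , z₀) ∷ (z₀ , v₀) ∷ []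
  t₃ = (z₋₁ , x₋₁) ∷ (x₋₁ , y₁) ∷ (y₀ , y₁) ∷ (x₁ , z₁) ∷ (y₁ , z₁) ∷ (z₁ , v₁) ∷ (v₁ , v₀) ∷ []
  t₄ = (y₁ , z₁) ∷ (z₁ , x₁) ∷ (z₋₁ , x₋₁) ∷ (x₁ , x₀) ∷ (x₋₁ , x₀) ∷ (x₀ , z₀) ∷ (z₀ , v₀) ∷ []
  t₅ = (x₁ , x₀) ∷ (y₀ , y₁) ∷ (x₀ , x₋₁) ∷ (y₁ , x₋₁) ∷ (x₋₁ , z₋₁) ∷ (z₋₁ , v₋₁) ∷ (v₋₁ , v₀) ∷ []
  t₆ = (z₋₁ , x₋₁) ∷ (x₋₁ , y₁) ∷ (y₁ , y₀) ∷ (y₀ , z₀) ∷ (z₀ , v₀) ∷ []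
  t₇ = (x₋₁ , y₁) ∷ (y₋₁ , x₁) ∷ (x₁ , z₁) ∷ (y₁ , z₁) ∷ (z₁ , v₁) ∷ (v₁ , v₀) ∷ []
  t₈ = (x₀ , x₋₁) ∷ (x₋₁ , y₁) ∷ (y₁ , y₀) ∷ (y₋₁ , y₀) ∷ (y₀ , z₀) ∷ (z₀ , v₀) ∷ []
  t₉ = (y₁ , x₋₁) ∷ (y₋₁ , x₁) ∷ (x₁ , x₀) ∷ (x₋₁ , x₀) ∷ (x₀ , z₀) ∷ (z₀ , v₀) ∷ []
  t₁₀ = (y₁ , x₋₁) ∷ (x₋₁ , z₋₁) ∷ (y₋₁ , z₋₁) ∷ (z₋₁ , v₋₁) ∷ (v₋₁ , v₀) ∷ []
  t₁₁ = (x₁ , y₋₁) ∷ (x₋₁ , y₁) ∷ (z₁ , y₁) ∷ (y₁ , y₀) ∷ (y₋₁ , y₀) ∷ (y₀ , z₀) ∷ (z₀ , v₀) ∷ []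
  t₁₂ = (y₋₁ , z₋₁) ∷ (y₁ , x₋₁) ∷ (z₋₁ , x₋₁) ∷ (x₋₁ , x₀) ∷ (x₀ , z₀) ∷ (z₀ , v₀) ∷ []
  t₁₃ = (y₁ , z₁) ∷ (y₋₁ , x₁) ∷ (z₁ , x₁) ∷ (x₁ , x₀) ∷ (x₀ , z₀) ∷ (z₀ , v₀) ∷ []
  t₁₄ = (x₋₁ , x₀) ∷ (z₋₁ , y₋₁) ∷ (x₀ , x₁) ∷ (y₋₁ , x₁) ∷ (x₁ , z₁) ∷ (z₁ , v₁) ∷ (v₁ , v₀) ∷ []
  t₁₅ = (y₋₁ , x₁) ∷ (z₁ , x₁) ∷ (x₁ , x₀) ∷ (x₋₁ , x₀) ∷ (x₀ , z₀) ∷ (z₀ , v₀) ∷ []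
  t₁₆ = (z₁ , y₁) ∷ (y₀ , y₋₁) ∷ (y₁ , x₋₁) ∷ (x₋₁ , z₋₁) ∷ (y₋₁ , z₋₁) ∷ (z₋₁ , v₋₁) ∷ (v₋₁ , v₀) ∷ []
  t₁₇ = (z₁ , x₁) ∷ (x₁ , x₀) ∷ (x₋₁ , x₀) ∷ (y₁ , y₀) ∷ (y₋₁ , y₀) ∷ (x₀ , z₀) ∷ (y₀ , z₀) ∷ (z₀ , v₀) ∷ []
  t₁₈ = (y₋₁ , y₀) ∷ (z₋₁ , x₋₁) ∷ (x₋₁ , y₁) ∷ (y₀ , y₁) ∷ (y₁ , z₁) ∷ (z₁ , v₁) ∷ (v₁ , v₀) ∷ []
  t₁₉ = (z₁ , x₁) ∷ (x₁ , y₋₁) ∷ (y₋₁ , z₋₁) ∷ (z₋₁ , v₋₁) ∷ (v₋₁ , v₀) ∷ []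

-- The x and y form the hexagon `x₀`, `x₁`, `y₋₁`, `y₀`, `y₁`, `x₋₁`, each z joins two opposite
-- corners to a v, and the v form a triangle. The hexagon is turned by one step.
rotate : Fin 12 → Fin 12
rotate = lookup (x₁ ∷ y₋₁ ∷ x₀ ∷ y₁ ∷ x₋₁ ∷ y₀ ∷ z₁ ∷ z₋₁ ∷ z₀ ∷ v₁ ∷ v₋₁ ∷ v₀ ∷ [])

-- rotate is an automorphism whose orbits on the vertices are the x and y, the
-- z, and the v.  Relabelled certificates are checked again, so invariance is
-- not needed.
certificate : Fin 12 → Certificate 12
certificate = lookup
  -- Each number counts the rotations that take the base root to the root in question; five lead
  -- from `x₀` to `x₋₁`, two to `y₋₁`.
  (turn 0 X ∷ turn 1 X ∷ turn 5 X ∷ turn 3 X ∷ turn 4 X ∷ turn 2 X ∷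
   turn 0 Z ∷ turn 1 Z ∷ turn 2 Z ∷ turn 0 V ∷ turn 1 V ∷ turn 2 V ∷ [])
  where
  X Z V : Certificate 12
  X = certificate-x₀
  Z = certificate-z₀
  V = certificate-v₀

  turn : ℕ → Certificate 12 → Certificate 12
  turn k = relabel (λ v → fold v rotate k)

-- Verification for all roots and the pebbling number.

J₃-adj? : Decidable (Adj J₃)
J₃-adj? u v = ((u , v) ∈? J₃-edges) ⊎-dec ((v , u) ∈? J₃-edges)
  where open DecMembership (Product.≡-dec (_≟_ {12}) (_≟_ {12})) using (_∈?_)

module J₃-Pebbling = Pebbling 12 J₃ J₃-adj?

J₃-valid : ∀ r →
           J₃-Pebbling.Valid r 12 (replicate 12 0) (replicate 12 12 [ r ]≔ 0) (certificate r)
-- The type checker evaluates the decision procedure on all twelve certificates.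
J₃-valid = toWitness {a? = Fin.all? λ r → J₃-Pebbling.valid? r 12 _ _ (certificate r)} _

theorem1 : Class0 J₃
theorem1 = (λ r → J₃-Pebbling.certified r 12 (certificate r) (J₃-valid r)) , order≤pebbling J₃
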